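{- Let $G$ be the $\sqrt{n}\times\sqrt{n}$ grid graph (so $G$ has $n$ vertices), and let $H$ be the cycle of $G$ formed by the vertices on the outer boundary of the grid. Then the optimal (minimum) stretch achievable by a retraction of $G$ to $H$ is at least $2\sqrt{n}/3$.
   Context: Let $G=(V,E)$ be an unweighted graph and $H=(A,E')$ a subgraph of $G$. A retraction of $G$ to $H$ is a map $f:V\to A$ with $f(v)=v$ for all $v\in A$ (no other condition is imposed). Let $d_H$ be the shortest-path metric of $H$. The stretch of an edge $(u,v)\in E$ under $f$ is $d_H(f(u),f(v))$, and the stretch of $f$ is the maximum stretch over all edges of $G$. The optimal stretch is the minimum of the stretch of $f$ over all retractions $f$ of $G$ to $H$. The $m\times m$ grid graph has vertex set $\{1,\dots,m\}^2$, with two vertices adjacent iff they differ by exactly 1 in exactly one coordinate.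
   Formalization: The side length √n is assumed to be at least 3: for the 2×2 grid the boundary is the whole graph, the identity is the only retraction and has stretch 1 < 4/3, and for smaller grids the boundary is not a cycle. -}

module Defs where

open import Level using (0ℓ)
open import Data.Nat using (ℕ; zero; suc; _≤_; ∣_-_∣)
open import Data.Nat.Properties using (∣-∣-comm; ∣n-n∣≡0)
open import Data.Fin using (Fin; toℕ)
open import Data.Product using (∃-syntax; _×_; _,_)
open import Data.Sum using (_⊎_; inj₁; inj₂)
open import Relation.Binary using (Rel; Symmetric; Irreflexive)
open import Relation.Binary.PropositionalEquality using (_≡_; refl; sym; trans)
open import Relation.Unary using (Pred; _∈_)

record Graph : Set₁ where
  field
    V           : Set
    Edge        : Rel V 0ℓ
    symmetric   : Symmetric Edge
    irreflexive : Irreflexive _≡_ Edge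

record Subgraph (G : Graph) : Set₁ where
  open Graph G
  field
    A          : Pred V 0ℓ
    Edge′      : Rel V 0ℓ
    symmetric′ : Symmetric Edge′
    edge⊆      : ∀ {u v} → Edge′ u v → Edge u v
    source∈    : ∀ {u v} → Edge′ u v → u ∈ A
    target∈    : ∀ {u v} → Edge′ u v → v ∈ A

induced : (G : Graph) → Pred (Graph.V G) 0ℓ → Subgraph G
induced G A = record
  { A          = A
  ; Edge′      = λ u v → u ∈ A × v ∈ A × Edge u v
  ; symmetric′ = λ (p , q , e) → q , p , symmetric e
  ; edge⊆      = λ (_ , _ , e) → e
  ; source∈    = λ (p , _ , _) → p
  ; target∈    = λ (_ , q , _) → q
  }
  where open Graph G

IsLeast : Pred ℕ 0ℓ → Pred ℕ 0ℓ
IsLeast P n = P n × (∀ k → P k → n ≤ k)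

module _ {G : Graph} (H : Subgraph G) where
  open Graph G
  open Subgraph H

  data Walk : ℕ → Rel V 0ℓ where
    stop : ∀ {v} → v ∈ A → Walk zero v v
    step : ∀ {k u v w} → Edge′ u v → Walk k v w → Walk (suc k) u w

  -- Distances are relational: if u and v are not connected in H, then no d
  -- satisfies IsDistance u v d.
  IsDistance : V → V → Pred ℕ 0ℓ
  IsDistance u v = IsLeast (λ k → Walk k u v)

  record Retraction : Set where
    field
      f     : V → V
      into  : ∀ v → f v ∈ A
      fixes : ∀ v → v ∈ A → f v ≡ v

  IsEdgeStretch : Retraction → V → V → Pred ℕ 0ℓ
  IsEdgeStretch r u v = IsDistance (f u) (f v)
    where open Retraction r

  -- Maximum over the edges of G: it is attained, and every edge has a (finite)
  -- stretch which it bounds.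
  IsStretch : Retraction → Pred ℕ 0ℓ
  IsStretch r s =
      (∃[ u ] ∃[ v ] Edge u v × IsEdgeStretch r u v s)
    × (∀ u v → Edge u v → ∃[ d ] IsEdgeStretch r u v d × d ≤ s)

  IsOptimalStretch : Pred ℕ 0ℓ
  IsOptimalStretch = IsLeast (λ s → ∃[ r ] IsStretch r s)

-- Coordinates run over 0, …, m − 1 rather than 1, …, m.
GridEdge : (m : ℕ) → Rel (Fin m × Fin m) 0ℓ
GridEdge m (i , j) (i′ , j′) =
    (∣ toℕ i - toℕ i′ ∣ ≡ 1 × j ≡ j′)
  ⊎ (i ≡ i′ × ∣ toℕ j - toℕ j′ ∣ ≡ 1)

grid : ℕ → Graph
grid m = record
  { V           = Fin m × Fin m
  ; Edge        = GridEdge m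
  ; symmetric   = λ
      { {i , _} {i′ , _} (inj₁ (d , e)) →
          inj₁ (trans (∣-∣-comm (toℕ i′) (toℕ i)) d , sym e)
      ; {_ , j} {_ , j′} (inj₂ (e , d)) →
          inj₂ (sym e , trans (∣-∣-comm (toℕ j′) (toℕ j)) d)
      }
  ; irreflexive = λ
      { {i , _} refl (inj₁ (d , _)) → 0≢1 (trans (sym (∣n-n∣≡0 (toℕ i))) d)
      ; {_ , j} refl (inj₂ (_ , d)) → 0≢1 (trans (sym (∣n-n∣≡0 (toℕ j))) d)
      }
  }
  where
  open import Relation.Nullary using (¬_)
  0≢1 : ¬ (0 ≡ 1)
  0≢1 ()

IsExtreme : {m : ℕ} → Pred (Fin m) 0ℓ
IsExtreme {m} i = toℕ i ≡ 0 ⊎ suc (toℕ i) ≡ m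

OnBoundary : (m : ℕ) → Pred (Fin m × Fin m) 0ℓ
OnBoundary m (i , j) = IsExtreme i ⊎ IsExtreme j

-- For m ≥ 2 every grid edge between boundary vertices runs along the boundary,
-- so the induced subgraph is exactly the boundary cycle, of length 4(m − 1).
boundaryCycle : (m : ℕ) → Subgraph (grid m)
boundaryCycle m = induced (grid m) (OnBoundary m)

{-# OPTIONS --safe #-}
-- Label the boundary cycle of the (n + 1) × (n + 1) grid by residues modulo its
-- length 4n. If all edges had stretch at most s < n, every grid edge would have
-- a well-defined signed displacement of absolute value at most s under the
-- retraction. Around a unit cell the displacements sum to a multiple of 4n of
-- absolute value at most 4s < 4n, hence to 0, so they sum to 0 around the whole
-- boundary as well. But the boundary is fixed, so it winds around once, a
-- contradiction. Hence s ≥ n = m − 1, and 3 (m − 1) ≥ 2m because m ≥ 3.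
module Submission where

open import Level using (0ℓ)
open import Data.Nat as ℕ using (ℕ; zero; suc; _≤_; _<_; _*_; z≤n; s≤s; _≤?_)
import Data.Nat.Properties as ℕₚ
import Data.Nat.Divisibility as ℕ∣
open import Data.Integer as ℤ using (ℤ; +_; -_; _+_; _-_; ∣_∣; 0ℤ; 1ℤ; -1ℤ)
import Data.Integer.Properties as ℤₚ
open import Data.Integer.Divisibility.Signed using (_∣_; ∣⇒∣ᵤ; ∣m⇒∣-m; ∣m∣n⇒∣m+n; ∣n⇒∣m*n; ∣-refl)
open import Data.Integer.Tactic.RingSolver using (solve-∀)
open import Data.Fin using (Fin; zero; suc; toℕ; inject₁; fromℕ)
import Data.Fin.Properties as Finₚ
open import Data.Vec.Functional using (Vector)
open import Data.Product using (∃-syntax; _×_; _,_; proj₁; proj₂)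
open import Data.Sum using (_⊎_; inj₁; inj₂)
open import Function using (_∘_)
open import Relation.Binary using (Rel)
open import Relation.Binary.PropositionalEquality
  using (_≡_; _≢_; refl; sym; trans; cong; cong₂; subst; module ≡-Reasoning)
open import Relation.Nullary using (yes; no; contradiction)
open import Algebra.Properties.CommutativeMonoid.Sum ℤₚ.+-0-commutativeMonoid using (sum)
open import Defs

-- Summation over a rectangle of cells, and consecutive naturals.

-- Each hypothesis is a commuting square; neighbouring squares share a side `v`, so gluing them in a
-- strip cancels all interior sides.
telescope : ∀ {n} (a b : Vector ℤ n) (v : Vector ℤ (suc n)) →
            (∀ j → a j + v (suc j) ≡ v (inject₁ j) + b j) →
            sum a + v (fromℕ n) ≡ v zero + sum b
telescope {zero}  a b v cell = trans (ℤₚ.+-identityˡ (v zero)) (sym (ℤₚ.+-identityʳ (v zero)))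
telescope {suc n} a b v cell = begin
  (a zero + sum (a ∘ suc)) + v (fromℕ (suc n))  ≡⟨ ℤₚ.+-assoc (a zero) _ _ ⟩
  a zero + (sum (a ∘ suc) + v (fromℕ (suc n)))
    ≡⟨ cong (λ z → a zero + z) (telescope (a ∘ suc) (b ∘ suc) (v ∘ suc) (cell ∘ suc)) ⟩
  a zero + (v (suc zero) + sum (b ∘ suc))       ≡⟨ ℤₚ.+-assoc (a zero) _ _ ⟨
  (a zero + v (suc zero)) + sum (b ∘ suc)       ≡⟨ cong (_+ sum (b ∘ suc)) (cell zero) ⟩
  (v zero + b zero) + sum (b ∘ suc)             ≡⟨ ℤₚ.+-assoc (v zero) _ _ ⟩
  v zero + (b zero + sum (b ∘ suc))             ∎
  where open ≡-Reasoning

-- Telescoping along a row of cells makes the row one large square with sides `sum (h i)`;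
-- telescoping again stacks these rows.
discrete-stokes : ∀ {m n} (h : Fin (suc m) → Vector ℤ n) (v : Fin m → Vector ℤ (suc n)) →
  (∀ i j → h (inject₁ i) j + v i (suc j) ≡ v i (inject₁ j) + h (suc i) j) →
  sum (λ i → v i zero) + sum (h (fromℕ m)) ≡ sum (h zero) + sum (λ i → v i (fromℕ n))
discrete-stokes {n = n} h v cell =
  telescope (λ i → v i zero) (λ i → v i (fromℕ n)) (λ i → sum (h i))
    (λ i → sym (telescope (h (inject₁ i)) (h (suc i)) (v i) (cell i)))

sum-constant : ∀ {n c} (t : Vector ℤ n) → (∀ j → t j ≡ c) → sum t ≡ + n ℤ.* c
sum-constant {zero}  {c} t eq = sym (ℤₚ.*-zeroˡ c)
sum-constant {suc n} {c} t eq =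
  trans (cong₂ _+_ (eq zero) (sum-constant (t ∘ suc) (eq ∘ suc)))
        (sym (ℤₚ.suc-* (+ n) c))

Consecutive : Rel ℕ 0ℓ
Consecutive k l = l ≡ suc k ⊎ k ≡ suc l

∣k-l∣≡1⇒consecutive : ∀ k l → ℕ.∣ k - l ∣ ≡ 1 → Consecutive k l
∣k-l∣≡1⇒consecutive zero    l       eq = inj₁ eq
∣k-l∣≡1⇒consecutive (suc k) zero    eq = inj₂ eq
∣k-l∣≡1⇒consecutive (suc k) (suc l) eq with ∣k-l∣≡1⇒consecutive k l eq
... | inj₁ p = inj₁ (cong suc p)
... | inj₂ p = inj₂ (cong suc p)

-- Residues modulo `M` and their small integer lifts.

module Congruence (M : ℕ) where

  infix 4 _≈_
  -- A record rather than a synonym for divisibility, so that `a` and `b` can be inferred from the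
  -- type.
  record _≈_ (a b : ℤ) : Set where
    constructor ∣⇒≈
    field ≈⇒∣ : + M ∣ a - b
  open _≈_ public

  ≈-reflexive : ∀ {a b} → a ≡ b → a ≈ b
  ≈-reflexive {a} refl = ∣⇒≈ (subst (+ M ∣_) (sym (ℤₚ.+-inverseʳ a)) (∣n⇒∣m*n 0ℤ ∣-refl))

  ≈-sym : ∀ {a b} → a ≈ b → b ≈ a
  ≈-sym {a} {b} p = ∣⇒≈ (subst (+ M ∣_) (eq a b) (∣m⇒∣-m (≈⇒∣ p)))
    where
    eq : ∀ a b → - (a - b) ≡ b - a
    eq = solve-∀

  ≈-trans : ∀ {a b c} → a ≈ b → b ≈ c → a ≈ c
  ≈-trans {a} {b} {c} p q = ∣⇒≈ (subst (+ M ∣_) (eq a b c) (∣m∣n⇒∣m+n (≈⇒∣ p) (≈⇒∣ q)))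
    where
    eq : ∀ a b c → (a - b) + (b - c) ≡ a - c
    eq = solve-∀

  +-cong : ∀ {a b c d} → a ≈ b → c ≈ d → a + c ≈ b + d
  +-cong {a} {b} {c} {d} p q = ∣⇒≈ (subst (+ M ∣_) (eq a b c d) (∣m∣n⇒∣m+n (≈⇒∣ p) (≈⇒∣ q)))
    where
    eq : ∀ a b c d → (a - b) + (c - d) ≡ (a + c) - (b + d)
    eq = solve-∀

  neg-cong : ∀ {a b} → a ≈ b → - a ≈ - b
  neg-cong {a} {b} p = ∣⇒≈ (subst (+ M ∣_) (eq a b) (∣m⇒∣-m (≈⇒∣ p)))
    where
    eq : ∀ a b → - (a - b) ≡ - a - - b
    eq = solve-∀

  -‿cong : ∀ {a b c d} → a ≈ b → c ≈ d → a - c ≈ b - d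
  -‿cong p q = +-cong p (neg-cong q)

  -- The only multiple of `M` of absolute value below `M` is 0.
  ≈⇒≡ : ∀ {a b} → a ≈ b → ∣ a - b ∣ < M → a ≡ b
  ≈⇒≡ {a} {b} p small = ℤₚ.i-j≡0⇒i≡j a b (ℤₚ.∣i∣≡0⇒i≡0 (vanish ∣ a - b ∣ (∣⇒∣ᵤ (≈⇒∣ p)) small))
    where
    vanish : ∀ k → M ℕ∣.∣ k → k < M → k ≡ 0
    vanish zero    _ _   = refl
    vanish (suc k) d k<M = contradiction d (ℕ∣.>⇒∤ k<M)

  -- The lift `shift` of the residue of `b - a` is kept as data, because the lifts themselves are
  -- summed later.
  record Near (k : ℕ) (a b : ℤ) : Set where
    constructor shift-by
    field
      shift   : ℤ
      small   : ∣ shift ∣ ≤ k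
      shifted : b - a ≈ shift
  open Near public

  near-refl : ∀ {a} → Near 0 a a
  near-refl {a} = shift-by 0ℤ z≤n (≈-reflexive (ℤₚ.+-inverseʳ a))

  near-sym : ∀ {k a b} → Near k a b → Near k b a
  near-sym {k} {a} {b} (shift-by δ δ≤ p) =
    shift-by (- δ) (subst (_≤ k) (sym (ℤₚ.∣-i∣≡∣i∣ δ)) δ≤)
             (≈-trans (≈-reflexive (eq a b)) (neg-cong p))
    where
    eq : ∀ a b → a - b ≡ - (b - a)
    eq = solve-∀

  near-trans : ∀ {k l a b c} → Near k a b → Near l b c → Near (k ℕ.+ l) a c
  near-trans {a = a} {b} {c} (shift-by δ δ≤ p) (shift-by ε ε≤ q) =
    shift-by (δ + ε) (ℕₚ.≤-trans (ℤₚ.∣i+j∣≤∣i∣+∣j∣ δ ε) (ℕₚ.+-mono-≤ δ≤ ε≤))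
             (≈-trans (≈-reflexive (eq a b c)) (+-cong p q))
    where
    eq : ∀ a b c → c - a ≡ (b - a) + (c - b)
    eq = solve-∀

  -- Both shifts lift the same residue, and they differ by at most `k + l`, which is too little for
  -- a nonzero multiple of `M`.
  shift-unique : ∀ {k l a b} → k ℕ.+ l < M → (p : Near k a b) (q : Near l a b) →
                 shift p ≡ shift q
  shift-unique k+l<M (shift-by δ δ≤ p) (shift-by ε ε≤ q) =
    ≈⇒≡ (≈-trans (≈-sym p) q)
        (ℕₚ.≤-<-trans (ℤₚ.∣i-j∣≤∣i∣+∣j∣ δ ε) (ℕₚ.≤-<-trans (ℕₚ.+-mono-≤ δ≤ ε≤) k+l<M))

  near-mono : ∀ {k l a b} → k ≤ l → Near k a b → Near l a b
  near-mono k≤l (shift-by δ δ≤ p) = shift-by δ (ℕₚ.≤-trans δ≤ k≤l) p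

  near-respˡ : ∀ {k a a′ b} → a ≈ a′ → Near k a b → Near k a′ b
  near-respˡ {b = b} a≈a′ (shift-by δ δ≤ p) =
    shift-by δ δ≤ (≈-trans (-‿cong (≈-reflexive {b} refl) (≈-sym a≈a′)) p)

-- Labels on the boundary cycle.

module Cycle (n : ℕ) where

  open Congruence (4 * n)

  Vertex : Set
  Vertex = Fin (suc n) × Fin (suc n)

  rank : Vertex → ℕ
  rank (i , j) = toℕ i ℕ.+ toℕ j

  -- Only meaningful on the boundary: the distance from (0 , 0) along the cycle,
  -- counted negatively below the diagonal; the two halves meet again at (n , n),
  -- where 2n ≈ − 2n.
  position : Vertex → ℤ
  position u@(i , j) with toℕ i ≤? toℕ j
  ... | yes _ = + rank u
  ... | no  _ = - (+ rank u)

  -- The two boundary paths from `(0 , 0)` to `(n , n)`: along the top and right sides, and along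
  -- the left and bottom sides. Both contain the two end corners.
  Upper Lower : Vertex → Set
  Upper (i , j) = toℕ i ≡ 0 ⊎ toℕ j ≡ n
  Lower (i , j) = toℕ i ≡ n ⊎ toℕ j ≡ 0

  upper⇒boundary : ∀ u → Upper u → OnBoundary (suc n) u
  upper⇒boundary _ (inj₁ i≡0) = inj₁ (inj₁ i≡0)
  upper⇒boundary _ (inj₂ j≡n) = inj₂ (inj₂ (cong suc j≡n))

  lower⇒boundary : ∀ u → Lower u → OnBoundary (suc n) u
  lower⇒boundary _ (inj₁ i≡n) = inj₁ (inj₂ (cong suc i≡n))
  lower⇒boundary _ (inj₂ j≡0) = inj₂ (inj₁ j≡0)

  upper-position : ∀ u → Upper u → position u ≈ + rank u
  upper-position (i , j) up with toℕ i ≤? toℕ j | up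
  ... | yes _   | _        = ≈-reflexive refl
  ... | no  i≰j | inj₁ i≡0 = contradiction (ℕₚ.≤-trans (ℕₚ.≤-reflexive i≡0) z≤n) i≰j
  ... | no  i≰j | inj₂ j≡n =
    contradiction (ℕₚ.≤-trans (Finₚ.toℕ≤pred[n] i) (ℕₚ.≤-reflexive (sym j≡n))) i≰j

  -- Only the corners `(0 , 0)` and `(n , n)` carry the other sign. At the first the rank is 0; at
  -- the second the labels `2n` and `- 2n` differ by the modulus `4n`.
  lower-position : ∀ u → Lower u → position u ≈ - (+ rank u)
  lower-position (i , j) low with toℕ i ≤? toℕ j | low
  ... | no  _   | _        = ≈-reflexive refl
  ... | yes i≤j | inj₂ j≡0
    rewrite j≡0 | ℕₚ.n≤0⇒n≡0 i≤j = ≈-reflexive refl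
  ... | yes i≤j | inj₁ i≡n
    rewrite i≡n | ℕₚ.≤-antisym (Finₚ.toℕ≤pred[n] j) i≤j =
      ∣⇒≈ (subst (+ (4 * n) ∣_) wrap ∣-refl)
    where
    eq : ∀ x → + 4 ℤ.* x ≡ (x + x) - - (x + x)
    eq = solve-∀

    wrap : + (4 * n) ≡ + (n ℕ.+ n) - - (+ (n ℕ.+ n))
    wrap = trans (ℤₚ.pos-* 4 n) (eq (+ n))

  suc-rank : ∀ k → + suc k - + k ≡ 1ℤ
  suc-rank k = eq (+ k)
    where
    eq : ∀ x → (1ℤ + x) - x ≡ 1ℤ
    eq = solve-∀

  neg-suc-rank : ∀ k → - (+ suc k) - - (+ k) ≡ -1ℤ
  neg-suc-rank k = eq (+ k)
    where
    eq : ∀ x → - (1ℤ + x) - - x ≡ -1ℤ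
    eq = solve-∀

  consecutive⇒near : ∀ {k l} → Consecutive k l → Near 1 (+ k) (+ l)
  consecutive⇒near {k} (inj₁ refl) = shift-by 1ℤ (s≤s z≤n) (≈-reflexive (suc-rank k))
  consecutive⇒near {l = l} (inj₂ refl) =
    near-sym (shift-by 1ℤ (s≤s z≤n) (≈-reflexive (suc-rank l)))

  consecutive⇒near-neg : ∀ {k l} → Consecutive k l → Near 1 (- (+ k)) (- (+ l))
  consecutive⇒near-neg {k} (inj₁ refl) = shift-by -1ℤ (s≤s z≤n) (≈-reflexive (neg-suc-rank k))
  consecutive⇒near-neg {l = l} (inj₂ refl) =
    near-sym (shift-by -1ℤ (s≤s z≤n) (≈-reflexive (neg-suc-rank l)))

  edge-rank : ∀ u v → GridEdge (suc n) u v → Consecutive (rank u) (rank v)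
  edge-rank (i , j) (i′ , _) (inj₁ (d , refl)) with ∣k-l∣≡1⇒consecutive (toℕ i) (toℕ i′) d
  ... | inj₁ p = inj₁ (cong (ℕ._+ toℕ j) p)
  ... | inj₂ p = inj₂ (cong (ℕ._+ toℕ j) p)
  edge-rank (i , j) (_ , j′) (inj₂ (refl , d)) with ∣k-l∣≡1⇒consecutive (toℕ j) (toℕ j′) d
  ... | inj₁ p = inj₁ (trans (cong (toℕ i ℕ.+_) p) (ℕₚ.+-suc (toℕ i) (toℕ j)))
  ... | inj₂ p = inj₂ (trans (cong (toℕ i ℕ.+_) p) (ℕₚ.+-suc (toℕ i) (toℕ j′)))

  -- An edge changes `i - j` by exactly 1, so it can pass from nonpositive to positive only by
  -- starting at 0.
  crossing⇒diagonal : ∀ u v → GridEdge (suc n) u v →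
    toℕ (proj₁ u) ≤ toℕ (proj₂ u) → toℕ (proj₂ v) < toℕ (proj₁ v) →
    toℕ (proj₁ u) ≡ toℕ (proj₂ u)
  crossing⇒diagonal (i , _) (i′ , _) (inj₁ (d , refl)) i≤j j<i′
    with ∣k-l∣≡1⇒consecutive (toℕ i) (toℕ i′) d
  ... | inj₁ p = ℕₚ.≤-antisym i≤j (ℕ.s≤s⁻¹ (subst (_ <_) p j<i′))
  ... | inj₂ p = contradiction (ℕₚ.≤-trans (ℕₚ.≤-reflexive (sym p)) i≤j) (ℕₚ.<⇒≱ (ℕₚ.m<n⇒m<1+n j<i′))
  crossing⇒diagonal (i , j) (_ , j′) (inj₂ (refl , d)) i≤j j′<i
    with ∣k-l∣≡1⇒consecutive (toℕ j) (toℕ j′) d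
  ... | inj₁ p = contradiction (ℕₚ.<-trans (subst (toℕ j <_) (sym p) (ℕₚ.n<1+n _)) j′<i) (ℕₚ.≤⇒≯ i≤j)
  ... | inj₂ p = ℕₚ.≤-antisym i≤j (subst (_≤ toℕ i) (sym p) j′<i)

  diagonal⇒lower : ∀ u → OnBoundary (suc n) u → toℕ (proj₁ u) ≡ toℕ (proj₂ u) → Lower u
  diagonal⇒lower _ (inj₁ (inj₁ i≡0)) i≡j = inj₂ (trans (sym i≡j) i≡0)
  diagonal⇒lower _ (inj₁ (inj₂ i≡n)) i≡j = inj₁ (ℕₚ.suc-injective i≡n)
  diagonal⇒lower _ (inj₂ (inj₁ j≡0)) i≡j = inj₂ j≡0
  diagonal⇒lower _ (inj₂ (inj₂ j≡n)) i≡j = inj₁ (trans i≡j (ℕₚ.suc-injective j≡n))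

  -- Here `u` is a corner on the diagonal, where the label agrees with its negative modulo `4n`;
  -- both ends can then be labelled as on the lower path.
  crossing-near : ∀ u v → GridEdge (suc n) u v → OnBoundary (suc n) u →
    toℕ (proj₁ u) ≤ toℕ (proj₂ u) → toℕ (proj₂ v) < toℕ (proj₁ v) →
    Near 1 (position u) (- (+ rank v))
  crossing-near u v e u∈ i≤j j′<i′ =
    near-respˡ (≈-sym (lower-position u (diagonal⇒lower u u∈ (crossing⇒diagonal u v e i≤j j′<i′))))
               (consecutive⇒near-neg (edge-rank u v e))

  above-position : ∀ u → toℕ (proj₁ u) ≤ toℕ (proj₂ u) → position u ≡ + rank u
  above-position (i , j) i≤j with toℕ i ≤? toℕ j
  ... | yes _   = refl
  ... | no  i≰j = contradiction i≤j i≰j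

  below-position : ∀ u → toℕ (proj₂ u) < toℕ (proj₁ u) → position u ≡ - (+ rank u)
  below-position (i , j) j<i with toℕ i ≤? toℕ j
  ... | yes i≤j = contradiction i≤j (ℕₚ.<⇒≱ j<i)
  ... | no  _   = refl

  edge-near : ∀ {u v} → Subgraph.Edge′ (boundaryCycle (suc n)) u v →
              Near 1 (position u) (position v)
  edge-near {u@(i , j)} {v@(i′ , j′)} (u∈ , v∈ , e)
    with ℕₚ.<-≤-connex (toℕ j) (toℕ i) | ℕₚ.<-≤-connex (toℕ j′) (toℕ i′)
  ... | inj₂ i≤j | inj₂ i′≤j′ rewrite above-position u i≤j | above-position v i′≤j′ =
    consecutive⇒near (edge-rank u v e)
  ... | inj₁ j<i | inj₁ j′<i′ rewrite below-position u j<i | below-position v j′<i′ =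
    consecutive⇒near-neg (edge-rank u v e)
  ... | inj₂ i≤j | inj₁ j′<i′ rewrite below-position v j′<i′ =
    crossing-near u v e u∈ i≤j j′<i′
  ... | inj₁ j<i | inj₂ i′≤j′ rewrite below-position u j<i =
    near-sym (crossing-near v u (Graph.symmetric (grid (suc n)) {u} {v} e) v∈ i′≤j′ j<i)

  -- This turns distances in the cycle into bounds on lifts of label differences.
  walk-near : ∀ {k u v} → Walk (boundaryCycle (suc n)) k u v →
              Near k (position u) (position v)
  walk-near (stop _)   = near-refl
  walk-near (step e w) = near-trans (edge-near e) (walk-near w)

  -- Displacements of grid edges under a retraction of small stretch.

  private
    inject₁-adjacent : ∀ {k} (i : Fin k) → ℕ.∣ toℕ (inject₁ i) - suc (toℕ i) ∣ ≡ 1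
    inject₁-adjacent zero    = refl
    inject₁-adjacent (suc i) = inject₁-adjacent i

    row : ∀ i (j : Fin n) → GridEdge (suc n) (i , inject₁ j) (i , suc j)
    row i j = inj₂ (refl , inject₁-adjacent j)

    column : ∀ (i : Fin n) j → GridEdge (suc n) (inject₁ i , j) (suc i , j)
    column i j = inj₁ (inject₁-adjacent i , refl)

    row-rank : ∀ i (j : Fin n) → rank (i , suc j) ≡ suc (rank (i , inject₁ j))
    row-rank i j rewrite Finₚ.toℕ-inject₁ j = ℕₚ.+-suc (toℕ i) (toℕ j)

    column-rank : ∀ (i : Fin n) j → rank (suc i , j) ≡ suc (rank (inject₁ i , j))
    column-rank i j rewrite Finₚ.toℕ-inject₁ i = refl

  module _ (r : Retraction (boundaryCycle (suc n))) {s : ℕ} (s<n : s < n)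
    (bounded : ∀ u v → GridEdge (suc n) u v →
               ∃[ d ] IsEdgeStretch (boundaryCycle (suc n)) r u v d × d ≤ s) where

    open Retraction r

    near : ∀ {u v} → GridEdge (suc n) u v → Near s (position (f u)) (position (f v))
    near {u} {v} e = let (_ , (w , _) , d≤s) = bounded u v e in near-mono d≤s (walk-near w)

    -- Read off from the walk that `bounded` supplies; since `2s < 4n`, any other walk of length at
    -- most `s` would give the same value.
    displacement : ∀ {u v} → GridEdge (suc n) u v → ℤ
    displacement {u} {v} e = shift (near {u} {v} e)

    -- Both routes from `u` to `x` lift the same label difference by at most `2s` each, and
    -- `2s + 2s < 4n`.
    cell : ∀ {u v w x} (uv : GridEdge (suc n) u v) (vx : GridEdge (suc n) v x)
           (uw : GridEdge (suc n) u w) (wx : GridEdge (suc n) w x) →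
           displacement {u} {v} uv + displacement {v} {x} vx
             ≡ displacement {u} {w} uw + displacement {w} {x} wx
    cell {u} {v} {w} {x} uv vx uw wx =
      shift-unique (begin-strict
        (s ℕ.+ s) ℕ.+ (s ℕ.+ s)    <⟨ ℕₚ.+-mono-< 2s<2n 2s<2n ⟩
        (n ℕ.+ n) ℕ.+ (n ℕ.+ n)    ≡⟨ ℕₚ.+-assoc n n (n ℕ.+ n) ⟩
        n ℕ.+ (n ℕ.+ (n ℕ.+ n))    ≡⟨ cong (λ k → n ℕ.+ (n ℕ.+ (n ℕ.+ k))) (ℕₚ.+-identityʳ n) ⟨
        4 * n                      ∎)
        (near-trans (near {u} {v} uv) (near {v} {x} vx))
        (near-trans (near {u} {w} uw) (near {w} {x} wx))
      where
      open ℕₚ.≤-Reasoning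
      2s<2n : s ℕ.+ s < n ℕ.+ n
      2s<2n = ℕₚ.+-mono-< s<n s<n

    -- As `f` fixes both ends, `c` is itself a lift of size 1, and `s + 1 < 4n` forces agreement.
    -- Labels enter only up to congruence, so a corner may take either sign.
    boundary-displacement : ∀ {u v a b c} (e : GridEdge (suc n) u v) →
      OnBoundary (suc n) u → OnBoundary (suc n) v → position u ≈ a → position v ≈ b →
      b - a ≡ c → ∣ c ∣ ≡ 1 → displacement {u} {v} e ≡ c
    boundary-displacement {u} {v} {a} {b} {c} e u∈ v∈ p q b-a≡c ∣c∣≡1 =
      shift-unique (begin-strict
        s ℕ.+ 1            ≡⟨ ℕₚ.+-comm s 1 ⟩
        suc s              ≤⟨ s<n ⟩
        -- Strictness needs `n` positive, which follows from `s < n`.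
        n                  <⟨ ℕₚ.m<m+n n (ℕₚ.≤-trans (ℕₚ.≤-trans (s≤s z≤n) s<n) (ℕₚ.m≤m+n n _)) ⟩
        4 * n              ∎)
        (near {u} {v} e)
        (shift-by c (ℕₚ.≤-reflexive ∣c∣≡1)
          (≈-trans (-‿cong (at v v∈ q) (at u u∈ p)) (≈-reflexive b-a≡c)))
      where
      open ℕₚ.≤-Reasoning
      at : ∀ w {x} → OnBoundary (suc n) w → position w ≈ x → position (f w) ≈ x
      at w w∈ = subst (λ z → position z ≈ _) (sym (fixes w w∈))

    upper-displacement : ∀ {u v} (e : GridEdge (suc n) u v) → Upper u → Upper v →
                         rank v ≡ suc (rank u) → displacement {u} {v} e ≡ 1ℤ
    upper-displacement {u} {v} e u∈ v∈ eq =
      boundary-displacement {u} {v} e (upper⇒boundary u u∈) (upper⇒boundary v v∈)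
        (upper-position u u∈) (upper-position v v∈)
        (trans (cong (λ k → + k - + rank u) eq) (suc-rank (rank u))) refl

    lower-displacement : ∀ {u v} (e : GridEdge (suc n) u v) → Lower u → Lower v →
                         rank v ≡ suc (rank u) → displacement {u} {v} e ≡ -1ℤ
    lower-displacement {u} {v} e u∈ v∈ eq =
      boundary-displacement {u} {v} e (lower⇒boundary u u∈) (lower⇒boundary v v∈)
        (lower-position u u∈) (lower-position v v∈)
        (trans (cong (λ k → - (+ k) - - (+ rank u)) eq) (neg-suc-rank (rank u))) refl

    -- Edges point towards increasing coordinates, so the sides of each cell form two directed paths
    -- between opposite corners.
    h : Fin (suc n) → Vector ℤ n
    h i j = displacement {i , inject₁ j} {i , suc j} (row i j)

    v : Fin n → Vector ℤ (suc n)
    v i j = displacement {inject₁ i , j} {suc i , j} (column i j)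

    -- The lower path accumulates `- 2n` and the upper path `2n`, yet the cells force equal totals;
    -- for positive `n` this is absurd.
    boundary-sums : + n ℤ.* -1ℤ + + n ℤ.* -1ℤ ≡ + n ℤ.* 1ℤ + + n ℤ.* 1ℤ
    boundary-sums = begin
      + n ℤ.* -1ℤ + + n ℤ.* -1ℤ
        ≡⟨ cong₂ _+_ (sum-constant _ left) (sum-constant _ bottom) ⟨
      sum (λ i → v i zero) + sum (h (fromℕ n))
        ≡⟨ discrete-stokes h v (λ i j → cell {inject₁ i , inject₁ j} {inject₁ i , suc j}
             {suc i , inject₁ j} {suc i , suc j} (row _ j) (column i _) (column i _) (row _ j)) ⟩
      sum (h zero) + sum (λ i → v i (fromℕ n))
        ≡⟨ cong₂ _+_ (sum-constant _ top) (sum-constant _ right) ⟩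
      + n ℤ.* 1ℤ + + n ℤ.* 1ℤ ∎
      where
      open ≡-Reasoning
      left : ∀ i → v i zero ≡ -1ℤ
      left i = lower-displacement {inject₁ i , zero} {suc i , zero}
        (column i zero) (inj₂ refl) (inj₂ refl) (column-rank i zero)
      bottom : ∀ j → h (fromℕ n) j ≡ -1ℤ
      bottom j = lower-displacement {fromℕ n , inject₁ j} {fromℕ n , suc j}
        (row (fromℕ n) j) (inj₁ (Finₚ.toℕ-fromℕ n)) (inj₁ (Finₚ.toℕ-fromℕ n)) (row-rank (fromℕ n) j)
      top : ∀ j → h zero j ≡ 1ℤ
      top j = upper-displacement {zero , inject₁ j} {zero , suc j}
        (row zero j) (inj₁ refl) (inj₁ refl) (row-rank zero j)
      right : ∀ i → v i (fromℕ n) ≡ 1ℤ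
      right i = upper-displacement {inject₁ i , fromℕ n} {suc i , fromℕ n}
        (column i (fromℕ n)) (inj₂ (Finₚ.toℕ-fromℕ n)) (inj₂ (Finₚ.toℕ-fromℕ n)) (column-rank i (fromℕ n))

-- The lower bound on the stretch.

n≤stretch : ∀ n (r : Retraction (boundaryCycle (suc n))) {s} →
            IsStretch (boundaryCycle (suc n)) r s → n ≤ s
-- Both totals vanish on a one-vertex grid, so this case stands apart.
n≤stretch zero    r _ = z≤n
n≤stretch (suc n) r {s} (_ , bounded) with ℕₚ.<-≤-connex s (suc n)
... | inj₂ n≤s = n≤s
... | inj₁ s<n = contradiction (Cycle.boundary-sums (suc n) r s<n bounded) (turns-differ n)
  where
  turns-differ : ∀ k → + suc k ℤ.* -1ℤ + + suc k ℤ.* -1ℤ ≢ + suc k ℤ.* 1ℤ + + suc k ℤ.* 1ℤ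
  -- The two sides compute to a negative and a nonnegative constructor.
  turns-differ k ()

lemma7 : ∀ (m : ℕ) → 3 ≤ m → ∀ (s : ℕ) → IsOptimalStretch (boundaryCycle m) s → 2 * m ≤ 3 * s
lemma7 (suc n) (s≤s 2≤n) s ((r , stretch) , _) = begin
  2 * suc n        ≡⟨ ℕₚ.*-suc 2 n ⟩
  2 ℕ.+ 2 * n      ≤⟨ ℕₚ.+-monoˡ-≤ (2 * n) 2≤n ⟩
  3 * n            ≤⟨ ℕₚ.*-monoʳ-≤ 3 (n≤stretch n r stretch) ⟩
  3 * s            ∎
  where open ℕₚ.≤-Reasoning
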